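{- Let $A$ be an $m\times n$ Archdeacon array on an abelian group $G$ with simple orderings $\omega_r=\omega_{\overline R_1}\circ\dots\circ\omega_{\overline R_m}$ for the rows and $\omega_c=\omega_{\overline C_1}\circ\dots\circ\omega_{\overline C_n}$ for the columns. Then: (1) $\mathcal{B}_{\omega_r}=\{\mathcal{S}(\omega_{\overline R_i})\mid 1\le i\le m\}$ is a set of base cycles of a $G$-regular cycle decomposition $\mathcal{D}_{\omega_r}$ of $\mathrm{Cay}[G:\pm\mathcal{E}(A)]$; (2) $\mathcal{B}_{\omega_c}=\{\mathcal{S}(\omega_{\overline C_j})\mid 1\le j\le n\}$ is a set of base cycles of a $G$-regular cycle decomposition $\mathcal{D}_{\omega_c}$ of $\mathrm{Cay}[G:\pm\mathcal{E}(A)]$; (3) the cycle decompositions $\mathcal{D}_{\omega_r}$ and $\mathcal{D}_{\omega_c}$ are orthogonal. (Empty rows and columns contribute no base cycle.)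
   Context: A partially filled (p.f.) array is a matrix in which some cells may be empty; $\mathcal{E}(A)$ is the list of the elements in the filled cells of $A$, and $\overline R_i,\overline C_j$ are its $i$-th row and $j$-th column. An Archdeacon array over an abelian group $(G,+)$ is an $m\times n$ p.f. array $A$ with elements in $G$ such that: (a) $\mathcal{E}(A)$ is a set (no repeated entries); (b) for every $g\in G$, $g\in\mathcal{E}(A)$ implies $-g\notin\mathcal{E}(A)$; (c) the elements in every row and column sum to $0$. An ordering $\omega=(t_1,\dots,t_\ell)$ of elements of $G$ has partial sums $s_i=t_1+\dots+t_i$, and $\mathcal{S}(\omega)=(s_1,\dots,s_\ell)$; $\omega$ is simple if $s_1,\dots,s_\ell$ are pairwise distinct. Here $\omega_{\overline R_i}$ and $\omega_{\overline C_j}$ are simple orderings of the entries of $\overline R_i$ and of $\overline C_j$, respectively. $\mathcal{S}(\omega)$ is regarded as the cycle with consecutive vertices $s_1,\dots,s_\ell$ (and $s_\ell$ adjacent to $s_1$). For $\Lambda\subseteq G\setminus\{0\}$ with $\Lambda=-\Lambda$, $\mathrm{Cay}[G:\Lambda]$ is the simple graph with vertex set $G$ in which $x,y$ are adjacent iff $x-y\in\Lambda$. A cycle decomposition of a graph $K$ is a set of cycles in $K$ whose edge sets partition $E(K)$ (cycles may have different lengths). For a graph with vertices in $G$, a cycle decomposition is $G$-regular if it is invariant under $G$ acting by translations on the vertex set $G$; a set $\mathcal{B}$ of cycles is a set of base cycles of it if the decomposition is $\{B+g\mid B\in\mathcal{B},\,g\in G\}$. Two decompositions $\mathcal{D},\mathcal{D}'$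 are orthogonal if every $B\in\mathcal{D}$ and every $B'\in\mathcal{D}'$ share at most one edge. -}

module Defs where

open import Level using (Level; _⊔_; suc)
open import Algebra.Bundles using (AbelianGroup)
open import Data.Fin.Base using (Fin)
open import Data.List.Base
  using (List; []; _∷_; _∷ʳ_; catMaybes; concat; foldr; length; map; tabulate; zip)
import Data.List.Membership.Setoid as Membership
import Data.List.Membership.Setoid.Properties as Membershipₚ
import Data.List.Relation.Binary.Permutation.Setoid as Permutation
open import Data.List.Relation.Unary.All using (All)
open import Data.List.Relation.Unary.Any using (Any)
import Data.List.Relation.Unary.Unique.Setoid as Uniqueness
open import Data.Maybe.Base using (Maybe)
open import Data.Nat.Base using (ℕ; _≤_)
open import Data.Product.Base using (∃; _×_; _,_; uncurry)
open import Data.Sum.Base using (_⊎_; inj₁; inj₂)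
open import Function.Base using (flip)
open import Function.Bundles using (_⇔_)
open import Relation.Binary.Bundles using (Setoid)
open import Relation.Binary.Core using (Rel)
open import Relation.Binary.Definitions using (Irreflexive; Symmetric; _Respects_; _Respects₂_)
open import Relation.Binary.PropositionalEquality.Core using (_≡_; _≢_)
open import Relation.Nullary.Negation.Core using (¬_)
open import Relation.Unary using (Pred)
import Algebra.Properties.Group as Groupₚ

------------------------------------------------------------------------
-- Simple graphs and cycle decompositions

record SimpleGraph {c ℓ} (V : Setoid c ℓ) (e : Level) : Set (c ⊔ ℓ ⊔ suc e) where
  open Setoid V
  infix 4 _~_
  field
    _~_         : Rel Carrier e
    ~-resp-≈    : _~_ Respects₂ _≈_
    symmetric   : Symmetric _~_
    irreflexive : Irreflexive _≈_ _~_

-- The cycle with consecutive vertices v₁, …, v_ℓ is written as the list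
-- v₁ ∷ … ∷ v_ℓ ∷ [], whose last vertex is also followed by its first.
cyclicPairs : ∀ {a} {A : Set a} → List A → List (A × A)
cyclicPairs []       = []
cyclicPairs (v ∷ vs) = zip (v ∷ vs) (vs ∷ʳ v)

module Cycles {c ℓ} (V : Setoid c ℓ) where

  open Setoid V
  open Membership V using (_∈_)
  open Uniqueness V using (Unique)

  -- Equality of the unordered pairs {x,y} and {u,v}.
  SameEdge : Rel (Carrier × Carrier) ℓ
  SameEdge (x , y) (u , v) = (x ≈ u × y ≈ v) ⊎ (x ≈ v × y ≈ u)

  HasEdge : List Carrier → Carrier → Carrier → Set (c ⊔ ℓ)
  HasEdge vs x y = Any (SameEdge (x , y)) (cyclicPairs vs)

  -- Equality of cycles as subgraphs: it ignores the starting vertex and the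
  -- direction in which a cycle is traversed.
  infix 4 _≈ᶜ_
  _≈ᶜ_ : Rel (List Carrier) (c ⊔ ℓ)
  vs ≈ᶜ ws = (∀ x → x ∈ vs ⇔ x ∈ ws) × (∀ x y → HasEdge vs x y ⇔ HasEdge ws x y)

  -- A set of cycles is given by a predicate on vertex lists that need not be
  -- closed under _≈ᶜ_, so such sets are compared up to _≈ᶜ_.
  infix 4 _⊆ᶜ_ _≐ᶜ_
  _⊆ᶜ_ : ∀ {p q} → Pred (List Carrier) p → Pred (List Carrier) q → Set (c ⊔ ℓ ⊔ p ⊔ q)
  D ⊆ᶜ D′ = ∀ {vs} → D vs → ∃ λ ws → D′ ws × vs ≈ᶜ ws

  _≐ᶜ_ : ∀ {p q} → Pred (List Carrier) p → Pred (List Carrier) q → Set (c ⊔ ℓ ⊔ p ⊔ q)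
  D ≐ᶜ D′ = D ⊆ᶜ D′ × D′ ⊆ᶜ D

  record IsCycle {e} (K : SimpleGraph V e) (vs : List Carrier) : Set (c ⊔ ℓ ⊔ e) where
    open SimpleGraph K
    field
      length≥3 : 3 ≤ length vs
      distinct : Unique vs
      adjacent : All (uncurry _~_) (cyclicPairs vs)

  record IsCycleDecomposition {e p} (K : SimpleGraph V e) (D : Pred (List Carrier) p)
                              : Set (c ⊔ ℓ ⊔ e ⊔ p) where
    open SimpleGraph K
    field
      isCycle  : ∀ {vs} → D vs → IsCycle K vs
      covers   : ∀ {x y} → x ~ y → ∃ λ vs → D vs × HasEdge vs x y
      disjoint : ∀ {vs ws x y} → D vs → D ws → HasEdge vs x y → HasEdge ws x y → vs ≈ᶜ ws

  Orthogonal : ∀ {p q} → Pred (List Carrier) p → Pred (List Carrier) q → Set (c ⊔ ℓ ⊔ p ⊔ q)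
  Orthogonal D D′ = ∀ {vs ws} → D vs → D′ ws → ∀ {x y u v} →
    HasEdge vs x y → HasEdge ws x y → HasEdge vs u v → HasEdge ws u v →
    SameEdge (x , y) (u , v)

------------------------------------------------------------------------
-- Notions over an abelian group, written additively

module _ {c ℓ} (G : AbelianGroup c ℓ) where

  open AbelianGroup G renaming (_∙_ to infixl 6 _+_; ε to 0#; _⁻¹ to infix 8 -_)
  open Membership setoid using (_∈_)
  open Uniqueness setoid using (Unique)
  open Permutation setoid using (_↭_)
  open Cycles setoid

  record ConnectionSet (p : Level) : Set (c ⊔ ℓ ⊔ suc p) where
    field
      Λ        : Pred Carrier p
      Λ-resp-≈ : Λ Respects _≈_
      0∉Λ      : ¬ Λ 0#
      -‿closed : ∀ {g} → Λ g → Λ (- g)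

  Cay : ∀ {p} → ConnectionSet p → SimpleGraph setoid p
  Cay S = record
    { _~_         = λ x y → Λ (x - y)
    ; ~-resp-≈    = (λ y≈z → Λ-resp-≈ (∙-congˡ (⁻¹-cong y≈z)))
                  , (λ x≈z → Λ-resp-≈ (∙-congʳ x≈z))
    ; symmetric   = λ {x} {y} x~y → Λ-resp-≈ (Groupₚ.⁻¹-anti-homo-// group x y) (-‿closed x~y)
    ; irreflexive = λ {x} {y} x≈y x~y →
        0∉Λ (Λ-resp-≈ (trans (∙-congʳ x≈y) (inverseʳ y)) x~y)
    }
    where open ConnectionSet S

  translate : Carrier → List Carrier → List Carrier
  translate g = map (_+ g)

  translateSet : ∀ {p} → Carrier → Pred (List Carrier) p → Pred (List Carrier) (c ⊔ p)
  translateSet g D vs = ∃ λ B → D B × vs ≡ translate g B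

  translates : ∀ {p} → Pred (List Carrier) p → Pred (List Carrier) (c ⊔ p)
  translates 𝓑 vs = ∃ λ g → translateSet g 𝓑 vs

  record IsRegularCycleDecomposition {e p} (K : SimpleGraph setoid e) (D : Pred (List Carrier) p)
                                     : Set (c ⊔ ℓ ⊔ e ⊔ p) where
    field
      isCycleDecomposition : IsCycleDecomposition K D
      invariant            : ∀ g → translateSet g D ≐ᶜ D

  record IsSetOfBaseCycles {e p q} (K : SimpleGraph setoid e)
                           (𝓑 : Pred (List Carrier) p) (D : Pred (List Carrier) q)
                           : Set (c ⊔ ℓ ⊔ e ⊔ p ⊔ q) where
    field
      isCycle   : ∀ {B} → 𝓑 B → IsCycle K B
      generates : D ≐ᶜ translates 𝓑

  sum : List Carrier → Carrier
  sum = foldr _+_ 0#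

  partialSumsFrom : Carrier → List Carrier → List Carrier
  partialSumsFrom s []       = []
  partialSumsFrom s (t ∷ ts) = s + t ∷ partialSumsFrom (s + t) ts

  -- The list s₁, …, s_ℓ, without the empty sum s₀ = 0.  Read as a closed
  -- vertex list it is the cycle 𝓢(ω).
  partialSums : List Carrier → List Carrier
  partialSums = partialSumsFrom 0#

  Simple : List Carrier → Set (c ⊔ ℓ)
  Simple ω = Unique (partialSums ω)

  IsSimpleOrderingOf : List Carrier → List Carrier → Set (c ⊔ ℓ)
  IsSimpleOrderingOf ω xs = ω ↭ xs × Simple ω

  PFArray : ℕ → ℕ → Set c
  PFArray m n = Fin m → Fin n → Maybe Carrier

  row : ∀ {m n} → PFArray m n → Fin m → List Carrier
  row A i = catMaybes (tabulate (A i))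

  col : ∀ {m n} → PFArray m n → Fin n → List Carrier
  col A = row (flip A)

  entries : ∀ {m n} → PFArray m n → List Carrier
  entries A = concat (tabulate (row A))

  record IsArchdeaconArray {m n} (A : PFArray m n) : Set (c ⊔ ℓ) where
    field
      distinct  : Unique (entries A)
      antisymm  : ∀ {g} → g ∈ entries A → ¬ (- g ∈ entries A)
      rowSum≈0  : ∀ i → sum (row A i) ≈ 0#
      colSum≈0  : ∀ j → sum (col A j) ≈ 0#

  ±entries : ∀ {m n} {A : PFArray m n} → IsArchdeaconArray A → ConnectionSet (c ⊔ ℓ)
  ±entries {A = A} arch = record
    { Λ        = λ g → g ∈ E ⊎ - g ∈ E
    ; Λ-resp-≈ = λ { x≈y (inj₁ x∈E)  → inj₁ (resp x≈y x∈E)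
                   ; x≈y (inj₂ -x∈E) → inj₂ (resp (⁻¹-cong x≈y) -x∈E) }
    ; 0∉Λ      = λ { (inj₁ 0∈E)  → 0∉E 0∈E
                   ; (inj₂ -0∈E) → 0∉E (resp ε⁻¹≈ε -0∈E) }
    ; -‿closed = λ { {g} (inj₁ g∈E)  → inj₂ (resp (sym (⁻¹-involutive g)) g∈E)
                   ; (inj₂ -g∈E) → inj₁ -g∈E }
    }
    where
    open Groupₚ group using (ε⁻¹≈ε; ⁻¹-involutive)
    E    = entries A
    resp : ∀ {x y} → x ≈ y → x ∈ E → y ∈ E
    resp = Membershipₚ.∈-resp-≈ setoid
    0∉E  : ¬ (0# ∈ E)
    0∉E 0∈E = IsArchdeaconArray.antisymm arch 0∈E (resp (sym ε⁻¹≈ε) 0∈E)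

  -- The cycles 𝓢(ω i), where ω i is an ordering of line i, the i-th row or
  -- the i-th column; empty lines contribute none.
  lineCycles : ∀ {k} → (Fin k → List Carrier) → (Fin k → List Carrier) → Pred (List Carrier) c
  lineCycles line ω B = ∃ λ i → line i ≢ [] × B ≡ partialSums (ω i)

{-# OPTIONS --safe #-}
module Submission where

-- The cycle 𝓢(ω) + g is the closed walk from g whose increments are the entries of ω, so each of its
-- edges, oriented along the walk, has as difference an entry of A.  As g and -g are never both
-- entries, a directed edge (x , y) of the Cayley graph carries one well-defined entry ±(y - x), which
-- determines the line i of A and the position in ω i, and then x determines g: this gives the
-- decomposition.  An edge shared by a row cycle and a column cycle must carry the entry of the cell
-- where the two lines meet, and each cycle has only one edge carrying it: this gives orthogonality.

open import Defs
open import Level using (Level; _⊔_)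
open import Algebra.Bundles using (AbelianGroup)
open import Data.Empty using (⊥; ⊥-elim)
open import Data.Fin.Base using (Fin; zero; suc)
open import Data.List.Base
  using (List; []; _∷_; _∷ʳ_; _++_; catMaybes; concat; fromMaybe; length; tabulate; zip)
import Data.List.Membership.Setoid as Membership
import Data.List.Membership.Setoid.Properties as Membershipₚ
import Data.List.Relation.Binary.Equality.Setoid as Equality
import Data.List.Relation.Binary.Permutation.Setoid as Permutation
import Data.List.Relation.Binary.Permutation.Setoid.Properties as Permutationₚ
open import Data.List.Relation.Binary.Pointwise using (Pointwise; []; _∷_; Any-resp-Pointwise)
open import Data.List.Relation.Unary.All as All using ([]; _∷_)
import Data.List.Relation.Unary.All.Properties as Allₚ
open import Data.List.Relation.Unary.AllPairs using ([]; _∷_)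
import Data.List.Relation.Unary.AllPairs.Properties as AllPairsₚ
open import Data.List.Relation.Unary.Any as Any using (Any; here; there)
import Data.List.Relation.Unary.Any.Properties as Anyₚ
import Data.List.Relation.Unary.Unique.Setoid as Uniqueness
import Data.List.Relation.Unary.Unique.Setoid.Properties as Uniqueₚ
open import Data.Maybe.Base using (Maybe; just; nothing)
open import Data.Nat.Base using (ℕ; _≤_; z≤n; s≤s)
open import Data.Product.Base using (∃; ∃₂; _×_; _,_; proj₁; proj₂; swap)
open import Data.Sum.Base as Sum using (_⊎_; inj₁; inj₂)
open import Function.Base using (flip; _∘_)
open import Function.Bundles using (mk⇔)
open import Relation.Binary.Bundles using (Setoid)
open import Relation.Binary.PropositionalEquality.Core as ≡ using (_≡_; _≢_)
open import Relation.Nullary.Negation.Core using (¬_)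
open import Relation.Unary using (Pred)
import Algebra.Properties.CommutativeSemigroup as CommutativeSemigroupₚ
import Algebra.Properties.Group as Groupₚ
import Relation.Binary.Reasoning.Setoid as ≈-Reasoning

-- Concatenations without repeated entries.

-- Makes a row a concatenation of cells, just as the list of all entries is a concatenation of rows,
-- so that the same lemmas serve both levels.
catMaybes≡concat : ∀ {a} {A : Set a} {n : ℕ} (f : Fin n → Maybe A) →
                   catMaybes (tabulate f) ≡ concat (tabulate (fromMaybe ∘ f))
catMaybes≡concat {n = ℕ.zero}  f = ≡.refl
catMaybes≡concat {n = ℕ.suc _} f with f zero
... | just x  = ≡.cong (x ∷_) (catMaybes≡concat (f ∘ suc))
... | nothing = catMaybes≡concat (f ∘ suc)

module UniqueLists {c ℓ : Level} (V : Setoid c ℓ) where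

  open Setoid V
  open Membership V using (_∈_)
  open Uniqueness V using (Unique)

  Unique-++⁻ˡ : ∀ xs {ys} → Unique (xs ++ ys) → Unique xs
  Unique-++⁻ˡ []       _        = []
  Unique-++⁻ˡ (x ∷ xs) (p ∷ ps) = Allₚ.++⁻ˡ xs p ∷ Unique-++⁻ˡ xs ps

  Unique-++⁻ʳ : ∀ xs {ys} → Unique (xs ++ ys) → Unique ys
  Unique-++⁻ʳ []       ps       = ps
  Unique-++⁻ʳ (x ∷ xs) (p ∷ ps) = Unique-++⁻ʳ xs ps

  Unique-++⇒disjoint : ∀ xs {ys v} → Unique (xs ++ ys) → v ∈ xs → v ∈ ys → ⊥
  Unique-++⇒disjoint (x ∷ xs) (p ∷ _) (here v≈x) v∈ys =
    Allₚ.All¬⇒¬Any (Allₚ.++⁻ʳ xs p) (Any.map (trans (sym v≈x)) v∈ys)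
  Unique-++⇒disjoint (x ∷ xs) (_ ∷ ps) (there v∈xs) v∈ys = Unique-++⇒disjoint xs ps v∈xs v∈ys

  ∈-concat-tabulate⁺ : ∀ {n v} (f : Fin n → List Carrier) i → v ∈ f i → v ∈ concat (tabulate f)
  ∈-concat-tabulate⁺ f i v∈ = Membershipₚ.∈-concat⁺ V (Anyₚ.tabulate⁺ i v∈)

  ∈-concat-tabulate⁻ : ∀ {n v} (f : Fin n → List Carrier) →
                       v ∈ concat (tabulate f) → ∃ λ i → v ∈ f i
  ∈-concat-tabulate⁻ f = Anyₚ.tabulate⁻ ∘ Membershipₚ.∈-concat⁻ V (tabulate f)

  -- Applied first to the rows of the array and then to the cells of one row, to pin an entry to a
  -- single cell.
  Unique-concat⇒disjoint : ∀ {n v} (f : Fin n → List Carrier) → Unique (concat (tabulate f)) →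
                           ∀ i j → v ∈ f i → v ∈ f j → i ≡ j
  Unique-concat⇒disjoint f u zero    zero    _ _ = ≡.refl
  Unique-concat⇒disjoint f u zero    (suc j) p q =
    ⊥-elim (Unique-++⇒disjoint (f zero) u p (∈-concat-tabulate⁺ (f ∘ suc) j q))
  Unique-concat⇒disjoint f u (suc i) zero    p q =
    ⊥-elim (Unique-++⇒disjoint (f zero) u q (∈-concat-tabulate⁺ (f ∘ suc) i p))
  Unique-concat⇒disjoint f u (suc i) (suc j) p q =
    ≡.cong suc (Unique-concat⇒disjoint (f ∘ suc) (Unique-++⁻ʳ (f zero) u) i j p q)

  Unique-concat⁻ : ∀ {n} (f : Fin n → List Carrier) → Unique (concat (tabulate f)) →
                   ∀ i → Unique (f i)
  Unique-concat⁻ f u zero    = Unique-++⁻ˡ (f zero) u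
  Unique-concat⁻ f u (suc i) = Unique-concat⁻ (f ∘ suc) (Unique-++⁻ʳ (f zero) u) i

  Unique-fromMaybe : ∀ x → Unique (fromMaybe x)
  Unique-fromMaybe (just _) = [] ∷ []
  Unique-fromMaybe nothing  = []

-- Directed edges of cycles.

module Arcs {c ℓ : Level} (V : Setoid c ℓ) where

  open Setoid V
  open Cycles V
  open Equality V using (_≋_; ≋-refl; ≋-sym)

  -- Orientation is kept, unlike in `SameEdge`, because along a walk `y - x` is an entry while
  -- `x - y` is only the negative of one.
  SameArc : Carrier × Carrier → Carrier × Carrier → Set ℓ
  SameArc (x , y) (u , v) = x ≈ u × y ≈ v

  HasArc : List Carrier → Carrier → Carrier → Set (c ⊔ ℓ)
  HasArc vs x y = Any (SameArc (x , y)) (cyclicPairs vs)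

  edge⇒arc : ∀ vs {x y} → HasEdge vs x y → HasArc vs x y ⊎ HasArc vs y x
  edge⇒arc _ = Sum.map₂ (Any.map swap) ∘ Anyₚ.Any-⊎⁻

  arc⇒edge : ∀ vs {x y} → HasArc vs x y → HasEdge vs x y
  arc⇒edge _ = Any.map inj₁

  HasEdge-sym : ∀ vs {x y} → HasEdge vs x y → HasEdge vs y x
  HasEdge-sym _ = Any.map (Sum.swap ∘ Sum.map swap swap)

  zip-resp-≋ : ∀ {ss ts us vs} → ss ≋ us → ts ≋ vs → Pointwise SameArc (zip ss ts) (zip us vs)
  zip-resp-≋ []       _        = []
  zip-resp-≋ (_ ∷ _)  []       = []
  zip-resp-≋ (p ∷ ps) (q ∷ qs) = (p , q) ∷ zip-resp-≋ ps qs

  cyclicPairs-resp-≋ : ∀ {vs ws} → vs ≋ ws → Pointwise SameArc (cyclicPairs vs) (cyclicPairs ws)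
  cyclicPairs-resp-≋ []       = []
  cyclicPairs-resp-≋ (p ∷ ps) = zip-resp-≋ (p ∷ ps) (Equality.++⁺ V ps (p ∷ []))

  HasArc-resp-≋ : ∀ {vs ws x y} → vs ≋ ws → HasArc vs x y → HasArc ws x y
  HasArc-resp-≋ = Any-resp-Pointwise resp ∘ cyclicPairs-resp-≋
    where
    resp : ∀ {e f g} → SameArc f g → SameArc e f → SameArc e g
    resp (p , q) (r , s) = trans r p , trans s q

  HasEdge-resp-≋ : ∀ {vs ws x y} → vs ≋ ws → HasEdge vs x y → HasEdge ws x y
  HasEdge-resp-≋ {vs} {ws} vs≋ws e with edge⇒arc vs e
  ... | inj₁ a = arc⇒edge ws (HasArc-resp-≋ vs≋ws a)
  ... | inj₂ a = HasEdge-sym ws (arc⇒edge ws (HasArc-resp-≋ vs≋ws a))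

  -- Rotations and reversals never arise: cycles that must agree turn out to be pointwise equal
  -- lists.
  ≋⇒≈ᶜ : ∀ {vs ws} → vs ≋ ws → vs ≈ᶜ ws
  ≋⇒≈ᶜ p =
    (λ _ → mk⇔ (Membershipₚ.∈-resp-≋ V p) (Membershipₚ.∈-resp-≋ V (≋-sym p))) ,
    (λ _ _ → mk⇔ (HasEdge-resp-≋ p) (HasEdge-resp-≋ (≋-sym p)))

  ≐ᶜ-refl : ∀ {p} {D : Pred (List Carrier) p} → D ≐ᶜ D
  ≐ᶜ-refl = (λ Dvs → _ , Dvs , ≋⇒≈ᶜ ≋-refl) , (λ Dvs → _ , Dvs , ≋⇒≈ᶜ ≋-refl)

-- Walks with prescribed increments.

module Walks {c ℓ : Level} (G : AbelianGroup c ℓ) where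

  open AbelianGroup G renaming (_∙_ to infixl 6 _+_; ε to 0#; _⁻¹ to infix 8 -_)
  open Membership setoid using (_∈_)
  open Uniqueness setoid using (Unique)
  open Cycles setoid
  open Arcs setoid
  open Equality setoid using (_≋_; ≋-refl; ≋-sym; ≋-trans)
  open Groupₚ group
  open CommutativeSemigroupₚ commutativeSemigroup using (xy∙z≈xz∙y)

  psums : Carrier → List Carrier → List Carrier
  psums = partialSumsFrom G

  -- Step s ts t x: the walk from s with increments ts makes a step t from the vertex x.
  data Step : Carrier → List Carrier → Carrier → Carrier → Set (c ⊔ ℓ) where
    here  : ∀ {s u us t x} → t ≈ u → x ≈ s → Step s (u ∷ us) t x
    there : ∀ {s u us t x} → Step (s + u) us t x → Step s (u ∷ us) t x

  Step-resp-≈ : ∀ {s s′ ts t t′ x x′} → s ≈ s′ → t ≈ t′ → x ≈ x′ →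
                Step s ts t x → Step s′ ts t′ x′
  Step-resp-≈ s≈ t≈ x≈ (here p q) = here (trans (sym t≈) p) (trans (sym x≈) (trans q s≈))
  Step-resp-≈ s≈ t≈ x≈ (there p)  = there (Step-resp-≈ (∙-congʳ s≈) t≈ x≈ p)

  Step⇒∈ : ∀ {s ts t x} → Step s ts t x → t ∈ ts
  Step⇒∈ (here p _) = here p
  Step⇒∈ (there p)  = there (Step⇒∈ p)

  -- Subtracting from `x` the increments that precede `t` gives the start; thus some walk takes the
  -- step `t` from any prescribed vertex.
  ∈⇒Step : ∀ {ts t} x → t ∈ ts → ∃ λ s → Step s ts t x
  ∈⇒Step x (here p) = x , here p refl
  ∈⇒Step {u ∷ _} x (there p) with ∈⇒Step x p
  ... | s , q = s - u , there (Step-resp-≈ (sym (//-rightDividesˡ u s)) refl refl q)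

  -- The offset of x from the start s depends only on t; stated without subtraction.
  Step-offset : ∀ {s s′ ts t x x′} → Unique ts → Step s ts t x → Step s′ ts t x′ → x + s′ ≈ x′ + s
  Step-offset {s} {s′} _ (here _ p) (here _ q) =
    trans (∙-congʳ p) (trans (comm s s′) (∙-congʳ (sym q)))
  Step-offset (u ∷ _) (here p _) (there q) =
    ⊥-elim (Allₚ.All¬⇒¬Any u (Any.map (trans (sym p)) (Step⇒∈ q)))
  Step-offset (u ∷ _) (there p) (here q _) =
    ⊥-elim (Allₚ.All¬⇒¬Any u (Any.map (trans (sym q)) (Step⇒∈ p)))
  Step-offset {s} {s′} {u ∷ _} {x = x} {x′} (_ ∷ us) (there p) (there q) =
    ∙-cancelʳ u _ _ (trans (assoc x s′ u) (trans (Step-offset us p q) (sym (assoc x′ s u))))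

  Arc : Carrier → List Carrier → Carrier → Carrier → Set (c ⊔ ℓ)
  Arc s ts x y = ∃ λ t → Step s ts t x × y ≈ x + t

  -- The successor `z` of the last vertex is arbitrary because the recursion moves the start `s`,
  -- while the vertex that closes the cycle stays fixed.
  zip-psums⁻ : ∀ s ts z {x y} → Any (SameArc (x , y)) (zip (s ∷ psums s ts) (psums s ts ∷ʳ z)) →
               Arc s ts x y ⊎ (x ≈ s + sum G ts × y ≈ z)
  zip-psums⁻ s []       z (here (p , q)) = inj₂ (trans p (sym (identityʳ s)) , q)
  zip-psums⁻ s (u ∷ us) z (here (p , q)) = inj₁ (u , here refl p , trans q (∙-congʳ (sym p)))
  zip-psums⁻ s (u ∷ us) z (there a) with zip-psums⁻ (s + u) us z a
  ... | inj₁ (t , p , q) = inj₁ (t , there p , q)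
  ... | inj₂ (p , q)     = inj₂ (trans p (assoc s u (sum G us)) , q)

  zip-psums⁺ : ∀ s ts z {x y} → Arc s ts x y ⊎ (x ≈ s + sum G ts × y ≈ z) →
               Any (SameArc (x , y)) (zip (s ∷ psums s ts) (psums s ts ∷ʳ z))
  zip-psums⁺ s []       z (inj₂ (p , q))              = here (trans p (identityʳ s) , q)
  zip-psums⁺ s (u ∷ us) z (inj₁ (t , here p q , r))   = here (q , trans r (∙-cong q p))
  zip-psums⁺ s (u ∷ us) z (inj₁ (t , there p , r))    =
    there (zip-psums⁺ (s + u) us z (inj₁ (t , p , r)))
  zip-psums⁺ s (u ∷ us) z (inj₂ (p , q))              =
    there (zip-psums⁺ (s + u) us z (inj₂ (trans p (sym (assoc s u (sum G us))) , q)))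

  -- As the increments sum to 0, the closing pair of the vertex list is the first step of the walk.
  closing : ∀ s u us → sum G (u ∷ us) ≈ 0# → s + u + sum G us ≈ s
  closing s u us Σ≈0 = trans (assoc s u (sum G us)) (trans (∙-congˡ Σ≈0) (identityʳ s))

  HasArc⇒Arc : ∀ s ts {x y} → sum G ts ≈ 0# → HasArc (psums s ts) x y → Arc s ts x y
  HasArc⇒Arc s (u ∷ us) Σ≈0 a with zip-psums⁻ (s + u) us (s + u) a
  ... | inj₁ (t , p , q) = t , there p , q
  ... | inj₂ (p , q) = u , here refl x≈s , trans q (∙-congʳ (sym x≈s))
    where x≈s = trans p (closing s u us Σ≈0)

  Arc⇒HasArc : ∀ s ts {x y} → sum G ts ≈ 0# → Arc s ts x y → HasArc (psums s ts) x y
  Arc⇒HasArc s (u ∷ us) Σ≈0 (t , there p , q) = zip-psums⁺ (s + u) us (s + u) (inj₁ (t , p , q))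
  Arc⇒HasArc s (u ∷ us) Σ≈0 (t , here p q , r) = zip-psums⁺ (s + u) us (s + u)
    (inj₂ (trans q (sym (closing s u us Σ≈0)) , trans r (∙-cong q p)))

  psums-cong : ∀ {s s′} ts → s ≈ s′ → psums s ts ≋ psums s′ ts
  psums-cong []       _  = []
  psums-cong (t ∷ ts) s≈ = ∙-congʳ s≈ ∷ psums-cong ts (∙-congʳ s≈)

  length-psums : ∀ s ts → length (psums s ts) ≡ length ts
  length-psums s []       = ≡.refl
  length-psums s (t ∷ ts) = ≡.cong ℕ.suc (length-psums (s + t) ts)

  -- By commutativity `g` moves from the end of each partial sum to its start, so a translated walk
  -- is a walk with the same increments from a shifted start.
  translate-psums : ∀ g s ts → translate G g (psums s ts) ≋ psums (s + g) ts
  translate-psums g s []       = []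
  translate-psums g s (t ∷ ts) = xy∙z≈xz∙y s t g ∷
    ≋-trans (translate-psums g (s + t) ts) (psums-cong ts (xy∙z≈xz∙y s t g))

  translate-partialSums : ∀ g ts → translate G g (partialSums G ts) ≋ psums g ts
  translate-partialSums g ts = ≋-trans (translate-psums g 0# ts) (psums-cong ts (identityˡ g))

  translate-+ : ∀ g h vs → translate G h (translate G g vs) ≋ translate G (g + h) vs
  translate-+ g h []       = []
  translate-+ g h (v ∷ vs) = assoc v g h ∷ translate-+ g h vs

  translate-cong : ∀ {g h} vs → g ≈ h → translate G g vs ≋ translate G h vs
  translate-cong []       g≈h = []
  translate-cong (v ∷ vs) g≈h = ∙-congˡ g≈h ∷ translate-cong vs g≈h

  -- Translating by `h` and then by `g` is translating by `h + g`, and every `h` arises in this way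
  -- from `h - g`.
  translates-invariant : ∀ {p} (𝓑 : Pred (List Carrier) p) g →
                         translateSet G g (translates G 𝓑) ≐ᶜ translates G 𝓑
  translates-invariant 𝓑 g = fwd , bwd
    where
    fwd : translateSet G g (translates G 𝓑) ⊆ᶜ translates G 𝓑
    fwd (_ , (h , B , B∈ , ≡.refl) , ≡.refl) =
      _ , (h + g , B , B∈ , ≡.refl) , ≋⇒≈ᶜ (translate-+ h g B)
    bwd : translates G 𝓑 ⊆ᶜ translateSet G g (translates G 𝓑)
    bwd (h , B , B∈ , ≡.refl) =
      _ , (_ , (h - g , B , B∈ , ≡.refl) , ≡.refl) ,
      ≋⇒≈ᶜ (≋-sym (≋-trans (translate-+ (h - g) g B) (translate-cong B (//-rightDividesˡ g h))))

  Simple⇒Unique-psums : ∀ s ts → Simple G ts → Unique (psums s ts)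
  Simple⇒Unique-psums s ts simple = Equality.Unique-resp-≋ setoid (translate-partialSums s ts)
    (Uniqueₚ.map⁺ setoid setoid (∙-cancelʳ s _ _) simple)

-- Translates of line cycles: decomposition and orthogonality.

module Decomposition {c ℓ : Level} (G : AbelianGroup c ℓ) {m n : ℕ} (A : PFArray G m n)
                     (arch : IsArchdeaconArray G A) where

  open AbelianGroup G renaming (_∙_ to infixl 6 _+_; ε to 0#; _⁻¹ to infix 8 -_)
  open Membership setoid using (_∈_)
  open Uniqueness setoid using (Unique)
  open Cycles setoid
  open Arcs setoid
  open Walks G
  open Equality setoid using (_≋_; ≋-refl; ≋-sym; ≋-trans; ≋-length)
  open Groupₚ group
  open ConnectionSet (±entries G arch) using (Λ; 0∉Λ)
  open IsArchdeaconArray arch using (antisymm)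
  open ≈-Reasoning setoid

  E : List Carrier
  E = entries G A

  K : SimpleGraph setoid (c ⊔ ℓ)
  K = Cay G (±entries G arch)

  ∈E-resp-≈ : ∀ {x y} → x ≈ y → x ∈ E → y ∈ E
  ∈E-resp-≈ = Membershipₚ.∈-resp-≈ setoid

  opposite-entries : ∀ {t u} → t ∈ E → u ∈ E → ¬ (t + u ≈ 0#)
  opposite-entries t∈ u∈ t+u≈0 = antisymm t∈ (∈E-resp-≈ (inverseʳ-unique _ _ t+u≈0) u∈)

  -- A single increment with sum 0 would be a zero entry, and two would be opposite entries;
  -- antisymmetry excludes both.
  cycle-length : ∀ ω → ω ≢ [] → (∀ {t} → t ∈ ω → t ∈ E) → sum G ω ≈ 0# → 3 ≤ length ω
  cycle-length []              ω≢[] _  _   = ⊥-elim (ω≢[] ≡.refl)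
  cycle-length (t ∷ [])        _    ⊆E Σ≈0 =
    ⊥-elim (0∉Λ (inj₁ (∈E-resp-≈ (trans (sym (identityʳ t)) Σ≈0) (⊆E (here refl)))))
  cycle-length (t ∷ u ∷ [])    _    ⊆E Σ≈0 = ⊥-elim
    (opposite-entries (⊆E (here refl)) (⊆E (there (here refl)))
      (trans (∙-congˡ (sym (identityʳ u))) Σ≈0))
  cycle-length (_ ∷ _ ∷ _ ∷ _) _    _  _   = s≤s (s≤s (s≤s z≤n))

  -- What an ordered line needs for its walks to be cycles, without reference to rows or columns, so
  -- that a row and a column can be compared.
  record IsStarter (ω : List Carrier) : Set (c ⊔ ℓ) where
    field
      unique : Unique ω
      simple : Simple G ω
      sum≈0  : sum G ω ≈ 0#
      ⊆E     : ∀ {t} → t ∈ ω → t ∈ E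

  open IsStarter

  -- The entry `t` is `y - x`, the negative of `x - y`; hence the second alternative of `Λ`.
  Arc⇒adjacent : ∀ {ω g x y} → IsStarter ω → Arc g ω x y → Λ (x - y)
  Arc⇒adjacent {x = x} {y} S (t , step , y≈x+t) = inj₂ (∈E-resp-≈ t≈ (⊆E S (Step⇒∈ step)))
    where
    t≈ : t ≈ - (x - y)
    t≈ = begin
      t             ≈⟨ \\-leftDividesʳ x t ⟨
      - x + (x + t) ≈⟨ ∙-congˡ y≈x+t ⟨
      - x + y       ≈⟨ comm (- x) y ⟩
      y - x         ≈⟨ ⁻¹-anti-homo-// x y ⟨
      - (x - y)     ∎

  -- The list `vs` is free up to `≋` because a translate of a base cycle agrees with a walk only
  -- pointwise up to `≈`.
  starter-isCycle : ∀ {ω g vs} → IsStarter ω → ω ≢ [] → vs ≋ psums g ω → IsCycle K vs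
  starter-isCycle {ω} {g} S ω≢[] vs≋ = record
    { length≥3 = ≡.subst (3 ≤_) (≡.sym (≡.trans (≋-length vs≋) (length-psums g ω)))
                   (cycle-length ω ω≢[] (⊆E S) (sum≈0 S))
    ; distinct = Equality.Unique-resp-≋ setoid (≋-sym vs≋) (Simple⇒Unique-psums g ω (simple S))
    ; adjacent = All.tabulate λ e∈ → Arc⇒adjacent S
        (HasArc⇒Arc g ω (sum≈0 S) (HasArc-resp-≋ vs≋ (Any.map (λ { ≡.refl → refl , refl }) e∈)))
    }

  CommonArc : Carrier → List Carrier → Carrier → List Carrier → Carrier → Carrier → Set (c ⊔ ℓ)
  CommonArc g ω g′ ω′ x y = ∃ λ t → Step g ω t x × Step g′ ω′ t x × y ≈ x + t

  -- Cancelling `x` shows that both steps are `y - x`, so one `t` serves both walks.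
  same-direction : ∀ {g ω g′ ω′ x y} → Arc g ω x y → Arc g′ ω′ x y → CommonArc g ω g′ ω′ x y
  same-direction {x = x} (t , p , q) (u , p′ , q′) =
    t , p , Step-resp-≈ refl (∙-cancelˡ x u t (trans (sym q′) q)) refl p′ , q

  -- Going from `x` to `y` by `t` and back by `u` forces `t + u ≈ 0#`, which two entries cannot
  -- satisfy.
  opposite-direction : ∀ {g ω g′ ω′ x y} → IsStarter ω → IsStarter ω′ →
                       Arc g ω x y → Arc g′ ω′ y x → ⊥
  opposite-direction {x = x} {y} S S′ (t , p , q) (u , p′ , q′) =
    opposite-entries (⊆E S (Step⇒∈ p)) (⊆E S′ (Step⇒∈ p′)) (∙-cancelˡ x (t + u) 0# (begin
      x + (t + u) ≈⟨ assoc x t u ⟨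
      x + t + u   ≈⟨ ∙-congʳ q ⟨
      y + u       ≈⟨ q′ ⟨
      x           ≈⟨ identityʳ x ⟨
      x + 0#      ∎))

  edge⇒Arc : ∀ {ω g vs x y} → IsStarter ω → vs ≋ psums g ω → HasEdge vs x y →
             Arc g ω x y ⊎ Arc g ω y x
  edge⇒Arc {ω} {g} {vs} S vs≋ =
    Sum.map to to ∘ edge⇒arc vs
    where to = λ {x} {y} a → HasArc⇒Arc g ω {x} {y} (sum≈0 S) (HasArc-resp-≋ vs≋ a)

  -- By antisymmetry of E, two of the cycles traverse a common edge in the same direction.
  common-edge : ∀ {ω g vs ω′ g′ ws x y} →
                IsStarter ω → vs ≋ psums g ω → IsStarter ω′ → ws ≋ psums g′ ω′ →
                HasEdge vs x y → HasEdge ws x y →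
                CommonArc g ω g′ ω′ x y ⊎ CommonArc g ω g′ ω′ y x
  common-edge S vs≋ S′ ws≋ e e′ with edge⇒Arc S vs≋ e | edge⇒Arc S′ ws≋ e′
  ... | inj₁ a | inj₁ a′ = inj₁ (same-direction a a′)
  ... | inj₂ a | inj₂ a′ = inj₂ (same-direction a a′)
  ... | inj₁ a | inj₂ a′ = ⊥-elim (opposite-direction S S′ a a′)
  ... | inj₂ a | inj₁ a′ = ⊥-elim (opposite-direction S S′ a a′)

  -- Covers rows and columns alike, so that the decomposition is proved once for both.
  record IsPartition {k : ℕ} (line : Fin k → List Carrier) : Set (c ⊔ ℓ) where
    field
      line-unique : ∀ i → Unique (line i)
      line-sum≈0  : ∀ i → sum G (line i) ≈ 0#
      disjoint    : ∀ {t} i j → t ∈ line i → t ∈ line j → i ≡ j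
      line⊆E      : ∀ {t} i → t ∈ line i → t ∈ E
      E⊆line      : ∀ {t} → t ∈ E → ∃ λ i → t ∈ line i

  module _ {k : ℕ} {line ω : Fin k → List Carrier}
           (ordering : ∀ i → IsSimpleOrderingOf G (ω i) (line i))
           (partition : IsPartition line) where

    open IsPartition partition
    open Permutation setoid using (_↭_; ↭-sym)

    𝓑 : Pred (List Carrier) c
    𝓑 = lineCycles G line ω

    ω↭line : ∀ i → ω i ↭ line i
    ω↭line i = proj₁ (ordering i)

    ω⇒line : ∀ {t} i → t ∈ ω i → t ∈ line i
    ω⇒line i = Permutationₚ.∈-resp-↭ setoid (ω↭line i)

    line⇒ω : ∀ {t} i → t ∈ line i → t ∈ ω i
    line⇒ω i = Permutationₚ.∈-resp-↭ setoid (↭-sym (ω↭line i))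

    starter : ∀ i → IsStarter (ω i)
    starter i = record
      { unique = Permutationₚ.Unique-resp-↭ setoid (↭-sym (ω↭line i)) (line-unique i)
      ; simple = proj₂ (ordering i)
      ; sum≈0  = trans (Permutationₚ.foldr-commMonoid setoid isCommutativeMonoid (ω↭line i))
                       (line-sum≈0 i)
      ; ⊆E     = line⊆E i ∘ ω⇒line i
      }

    ω-nonempty : ∀ i → line i ≢ [] → ω i ≢ []
    ω-nonempty i line≢[] ω≡[] with line i in eq
    ... | []     = line≢[] ≡.refl
    ... | t ∷ ts with ≡.subst (t ∈_) ω≡[] (line⇒ω i (≡.subst (t ∈_) (≡.sym eq) (here refl)))
    ...   | ()

    translates⇒psums : ∀ {vs} → translates G 𝓑 vs →
                       ∃₂ λ i g → line i ≢ [] × vs ≋ psums g (ω i)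
    translates⇒psums (g , _ , (i , line≢[] , ≡.refl) , ≡.refl) =
      i , g , line≢[] , translate-partialSums g (ω i)

    base-isCycle : ∀ {B} → 𝓑 B → IsCycle K B
    base-isCycle (i , line≢[] , ≡.refl) =
      starter-isCycle (starter i) (ω-nonempty i line≢[]) ≋-refl

    translates-isCycle : ∀ {vs} → translates G 𝓑 vs → IsCycle K vs
    translates-isCycle D with translates⇒psums D
    ... | i , g , line≢[] , vs≋ = starter-isCycle (starter i) (ω-nonempty i line≢[]) vs≋

    -- Existence half of the decomposition: `t` occurs on some line, and the start is chosen so that
    -- the walk of this line takes the step `t` from `x`.
    translates-arc : ∀ {t} x y → t ∈ E → y ≈ x + t → ∃ λ vs → translates G 𝓑 vs × HasArc vs x y
    translates-arc x y t∈E y≈ with E⊆line t∈E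
    ... | i , t∈line with ∈⇒Step x (line⇒ω i t∈line)
    ...   | g , step =
      _ , (g , _ , (i , line≢[] , ≡.refl) , ≡.refl) ,
      HasArc-resp-≋ (≋-sym (translate-partialSums g (ω i)))
        (Arc⇒HasArc g (ω i) (sum≈0 (starter i)) (_ , step , y≈))
      where
      line≢[] : line i ≢ []
      line≢[] eq with ≡.subst (_ ∈_) eq t∈line
      ... | ()

    translates-covers : ∀ {x y} → Λ (x - y) → ∃ λ vs → translates G 𝓑 vs × HasEdge vs x y
    -- When `x - y` itself is the entry, the walk runs from `y` to `x`.
    translates-covers {x} {y} (inj₁ t∈E)
      with translates-arc y x t∈E (sym (trans (comm y (x - y)) (//-rightDividesˡ y x)))
    ... | vs , D , a = vs , D , HasEdge-sym vs (arc⇒edge vs a)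
    translates-covers {x} {y} (inj₂ t∈E)
      with translates-arc x y t∈E (sym (trans (∙-congˡ (⁻¹-anti-homo-// x y))
                                       (trans (comm x (y - x)) (//-rightDividesˡ x y))))
    ... | vs , D , a = vs , D , arc⇒edge vs a

    -- Uniqueness half: `t` lies on only one line, so `i` and `j` agree; `t` occurs once in that
    -- ordering, so leaving the same `x` by `t` forces the same start.
    common-arc⇒≋ : ∀ {g g′ i j x y} → CommonArc g (ω i) g′ (ω j) x y →
                   psums g (ω i) ≋ psums g′ (ω j)
    common-arc⇒≋ {g} {g′} {i} {j} {x} (t , p , p′ , _)
      with disjoint i j (ω⇒line i (Step⇒∈ p)) (ω⇒line j (Step⇒∈ p′))
    ... | ≡.refl =
      psums-cong (ω i) (sym (∙-cancelˡ x g′ g (Step-offset (unique (starter i)) p p′)))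

    translates-disjoint : ∀ {vs ws x y} → translates G 𝓑 vs → translates G 𝓑 ws →
                          HasEdge vs x y → HasEdge ws x y → vs ≈ᶜ ws
    translates-disjoint D D′ e e′ with translates⇒psums D | translates⇒psums D′
    ... | i , g , _ , vs≋ | j , g′ , _ , ws≋ =
      ≋⇒≈ᶜ (≋-trans vs≋ (≋-trans g≋g′ (≋-sym ws≋)))
      where
      g≋g′ : psums g (ω i) ≋ psums g′ (ω j)
      g≋g′ = Sum.[ common-arc⇒≋ , common-arc⇒≋ ]
               (common-edge (starter i) vs≋ (starter j) ws≋ e e′)

    translates-decompose : IsRegularCycleDecomposition G K (translates G 𝓑) ×
                           IsSetOfBaseCycles G K 𝓑 (translates G 𝓑)
    translates-decompose =
      record
        { isCycleDecomposition = record
            { isCycle  = translates-isCycle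
            ; covers   = translates-covers
            ; disjoint = translates-disjoint
            }
        ; invariant = translates-invariant 𝓑
        } ,
      record { isCycle = base-isCycle ; generates = ≐ᶜ-refl }

  -- Each shared edge carries an entry common to the two lines. By the last hypothesis there is at
  -- most one such entry, and a walk uses it only once.
  translates-orthogonal :
    ∀ {k l} {line ω : Fin k → List Carrier} {line′ ω′ : Fin l → List Carrier}
    (ordering : ∀ i → IsSimpleOrderingOf G (ω i) (line i)) → IsPartition line →
    (ordering′ : ∀ j → IsSimpleOrderingOf G (ω′ j) (line′ j)) → IsPartition line′ →
    (∀ {t u} i j → t ∈ line i → t ∈ line′ j → u ∈ line i → u ∈ line′ j → t ≈ u) →
    Orthogonal (translates G (lineCycles G line ω)) (translates G (lineCycles G line′ ω′))
  translates-orthogonal {ω = ω} {ω′ = ω′} o P o′ P′ meet {vs} {ws} D D′ {x} {y} {u} {v} e e′ f f′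
    with translates⇒psums o P D | translates⇒psums o′ P′ D′
  ... | i , g , _ , vs≋ | j , g′ , _ , ws≋ = combine (common e e′) (common f f′)
    where
    S : IsStarter (ω i)
    S = starter o P i
    Common : Carrier → Carrier → Set (c ⊔ ℓ)
    Common = CommonArc g (ω i) g′ (ω′ j)
    common : ∀ {x y} → HasEdge vs x y → HasEdge ws x y → Common x y ⊎ Common y x
    common = common-edge S vs≋ (starter o′ P′ j) ws≋
    same : ∀ {x y u v} → Common x y → Common u v → x ≈ u × y ≈ v
    same (t , p , p′ , q) (s , r , r′ , z) = x≈u , trans q (trans (∙-cong x≈u t≈s) (sym z))
      where
      t≈s = meet i j (ω⇒line o P i (Step⇒∈ p)) (ω⇒line o′ P′ j (Step⇒∈ p′))
                     (ω⇒line o P i (Step⇒∈ r)) (ω⇒line o′ P′ j (Step⇒∈ r′))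
      -- Both steps belong to the one walk from `g`, so equal offsets mean equal vertices.
      x≈u = ∙-cancelʳ g _ _ (Step-offset (unique S) p (Step-resp-≈ refl (sym t≈s) refl r))
    combine : Common x y ⊎ Common y x → Common u v ⊎ Common v u → SameEdge (x , y) (u , v)
    combine (inj₁ a) (inj₁ b) = inj₁ (same a b)
    combine (inj₂ a) (inj₂ b) = inj₁ (swap (same a b))
    combine (inj₁ a) (inj₂ b) = inj₂ (same a b)
    combine (inj₂ a) (inj₁ b) = inj₂ (swap (same a b))

-- Cells, rows and columns of an array.

module Grid {c ℓ : Level} (G : AbelianGroup c ℓ) where

  open AbelianGroup G
  open Membership setoid using (_∈_)
  open Uniqueness setoid using (Unique)
  open UniqueLists setoid

  -- A list of length at most one, so that membership treats empty and filled cells uniformly.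
  cell : ∀ {m n} → PFArray G m n → Fin m → Fin n → List Carrier
  cell A i j = fromMaybe (A i j)

  module _ {m n : ℕ} (A : PFArray G m n) where

    ∈-row⁺ : ∀ {g} i j → g ∈ cell A i j → g ∈ row G A i
    ∈-row⁺ {g} i j p = ≡.subst (g ∈_) (≡.sym (catMaybes≡concat (A i)))
      (∈-concat-tabulate⁺ (cell A i) j p)

    ∈-row⁻ : ∀ {g} i → g ∈ row G A i → ∃ λ j → g ∈ cell A i j
    ∈-row⁻ {g} i p = ∈-concat-tabulate⁻ (cell A i) (≡.subst (g ∈_) (catMaybes≡concat (A i)) p)

    ∈-entries⁺ : ∀ {g} i j → g ∈ cell A i j → g ∈ entries G A
    ∈-entries⁺ i j p = ∈-concat-tabulate⁺ (row G A) i (∈-row⁺ i j p)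

    ∈-entries⁻ : ∀ {g} → g ∈ entries G A → ∃₂ λ i j → g ∈ cell A i j
    ∈-entries⁻ p with ∈-concat-tabulate⁻ (row G A) p
    ... | i , q = i , ∈-row⁻ i q

    -- Unlike uniqueness of the row-by-row list of entries, this form is symmetric in rows and
    -- columns and passes directly to `flip A`.
    CellsDistinct : Set (c ⊔ ℓ)
    CellsDistinct = ∀ {g} i j i′ j′ → g ∈ cell A i j → g ∈ cell A i′ j′ → i ≡ i′ × j ≡ j′

    Unique⇒CellsDistinct : Unique (entries G A) → CellsDistinct
    Unique⇒CellsDistinct u i j i′ j′ p q
      with Unique-concat⇒disjoint (row G A) u i i′ (∈-row⁺ i j p) (∈-row⁺ i′ j′ q)
    ... | ≡.refl = ≡.refl ,
      Unique-concat⇒disjoint (cell A i)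
        (≡.subst Unique (catMaybes≡concat (A i)) (Unique-concat⁻ (row G A) u i)) j j′ p q

    CellsDistinct⇒Unique-row : CellsDistinct → ∀ i → Unique (row G A i)
    CellsDistinct⇒Unique-row d i = ≡.subst Unique (≡.sym (catMaybes≡concat (A i)))
      (Uniqueₚ.concat⁺ setoid (Allₚ.tabulate⁺ λ j → Unique-fromMaybe (A i j))
        (AllPairsₚ.tabulate⁺ λ j≢j′ (p , q) → j≢j′ (proj₂ (d i _ i _ p q))))

    CellsDistinct⇒disjoint-rows : CellsDistinct → ∀ {g} i i′ →
                                  g ∈ row G A i → g ∈ row G A i′ → i ≡ i′
    CellsDistinct⇒disjoint-rows d i i′ p q with ∈-row⁻ i p | ∈-row⁻ i′ q
    ... | j , p′ | j′ , q′ = proj₁ (d i j i′ j′ p′ q′)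

  -- The memberships place `g` in a cell of row `i` and in a cell of column `j`; an entry has only
  -- one cell, so both are the crossing.
  ∈-row-col⇒∈-cell : ∀ {m n} (A : PFArray G m n) → CellsDistinct A →
                     ∀ {g} i j → g ∈ row G A i → g ∈ col G A j → g ∈ cell A i j
  ∈-row-col⇒∈-cell A d i j p q with ∈-row⁻ A i p | ∈-row⁻ (flip A) j q
  ... | j′ , p′ | i′ , q′ with d i j′ i′ j p′ q′
  ...   | _ , ≡.refl = p′

  ∈-fromMaybe-unique : ∀ {g h} (x : Maybe Carrier) → g ∈ fromMaybe x → h ∈ fromMaybe x → g ≈ h
  ∈-fromMaybe-unique (just _) (here p) (here q) = trans p (sym q)

  module _ {m n : ℕ} (A : PFArray G m n) (arch : IsArchdeaconArray G A) where

    open Decomposition G A arch using (IsPartition)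
    open IsArchdeaconArray arch

    cells-distinct : CellsDistinct A
    cells-distinct = Unique⇒CellsDistinct A distinct

    rows-partition : IsPartition (row G A)
    rows-partition = record
      { line-unique = CellsDistinct⇒Unique-row A cells-distinct
      ; line-sum≈0  = rowSum≈0
      ; disjoint    = CellsDistinct⇒disjoint-rows A cells-distinct
      ; line⊆E      = ∈-concat-tabulate⁺ (row G A)
      ; E⊆line      = ∈-concat-tabulate⁻ (row G A)
      }

    cols-partition : IsPartition (col G A)
    cols-partition = record
      { line-unique = CellsDistinct⇒Unique-row (flip A) flipped
      ; line-sum≈0  = colSum≈0
      ; disjoint    = CellsDistinct⇒disjoint-rows (flip A) flipped
      -- `E` is listed by rows, so a column reaches it through individual cells.
      ; line⊆E      = λ j p → let i , q = ∈-row⁻ (flip A) j p in ∈-entries⁺ A i j q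
      ; E⊆line      = λ p → let i , j , q = ∈-entries⁻ A p in j , ∈-row⁺ (flip A) j i q
      }
      where
      flipped : CellsDistinct (flip A)
      flipped j i j′ i′ p q = swap (cells-distinct i j i′ j′ p q)

    -- Both entries lie in the cell where the row and the column cross, which holds at most one.
    row-col-meet : ∀ {t u} i j → t ∈ row G A i → t ∈ col G A j →
                   u ∈ row G A i → u ∈ col G A j → t ≈ u
    row-col-meet i j p q r s = ∈-fromMaybe-unique (A i j)
      (∈-row-col⇒∈-cell A cells-distinct i j p q) (∈-row-col⇒∈-cell A cells-distinct i j r s)

proposition5p3 : {c ℓ : Level} (G : AbelianGroup c ℓ) →
    let open AbelianGroup G using (Carrier) in
    (m n : ℕ) (A : PFArray G m n) (arch : IsArchdeaconArray G A)
    (ωr : Fin m → List Carrier) (ωc : Fin n → List Carrier) →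
    (∀ i → IsSimpleOrderingOf G (ωr i) (row G A i)) →
    (∀ j → IsSimpleOrderingOf G (ωc j) (col G A j)) →
    let K  = Cay G (±entries G arch)
        𝓑r = lineCycles G (row G A) ωr
        𝓑c = lineCycles G (col G A) ωc
    in
    ∃₂ λ (𝓓r 𝓓c : Pred (List Carrier) c) →
      (IsRegularCycleDecomposition G K 𝓓r × IsSetOfBaseCycles G K 𝓑r 𝓓r) ×
      (IsRegularCycleDecomposition G K 𝓓c × IsSetOfBaseCycles G K 𝓑c 𝓓c) ×
      Cycles.Orthogonal (AbelianGroup.setoid G) 𝓓r 𝓓c
proposition5p3 G m n A arch ωr ωc or oc =
  -- Each decomposition is taken to be the set of all translates, so its generation by the base
  -- cycles is reflexivity.
  translates G (lineCycles G (row G A) ωr) ,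
  translates G (lineCycles G (col G A) ωc) ,
  translates-decompose or rows ,
  translates-decompose oc cols ,
  translates-orthogonal or rows oc cols (row-col-meet A arch)
  where
  open Decomposition G A arch
  open Grid G
  rows = rows-partition A arch
  cols = cols-partition A arch
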